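{- For every $n$, there is a bijection between the set $S_n(\{2143,2341,3412\})$ of $\{2143,2341,3412\}$-avoiders in $S_n$ and the set $S_n(\{2143,2341,3421\})$ of $\{2143,2341,3421\}$-avoiders in $S_n$.
   Context: $S_n$ is the set of permutations of $[n]=\{1,\dots,n\}$ in one-line notation. For a set $T$ of patterns, $S_n(T)$ denotes the set of permutations $\pi\in S_n$ that avoid every pattern $\tau\in T$, i.e. no subsequence of $\pi$ is order-isomorphic to $\tau$. -}

module Defs where

open import Data.Fin.Base using (Fin; _<_)
open import Data.Fin.Patterns using (0F; 1F; 2F; 3F)
open import Data.Fin.Permutation using (Permutation′; permutation; _⟨$⟩ʳ_; _≈_)
open import Data.Fin.Properties using (_≟_; all?)
open import Data.List.Base using (List)
open import Data.List.Relation.Unary.All using (All)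
open import Data.Nat.Base using (ℕ)
open import Data.Product.Base using (Σ; _×_; _,_; ∃; proj₁; proj₂)
open import Data.Vec.Base using (Vec; lookup; _∷_; [])
open import Function.Bundles using (_⇔_)
open import Level using (0ℓ)
open import Relation.Binary.Bundles using (Setoid)
open import Relation.Binary.Core using (_Preserves_⟶_)
open import Relation.Binary.PropositionalEquality using (_≡_; refl; sym; trans)
open import Relation.Nullary using (¬_)
open import Relation.Nullary.Decidable using (True; toWitness)

Pattern : Set
Pattern = ∃ Permutation′

-- f lists the positions of a subsequence of π order-isomorphic to τ.
IsOccurrence : ∀ {k n} → Permutation′ k → Permutation′ n → (Fin k → Fin n) → Set
IsOccurrence τ π f =
  f Preserves _<_ ⟶ _<_ ×
  (∀ i j → (τ ⟨$⟩ʳ i < τ ⟨$⟩ʳ j) ⇔ (π ⟨$⟩ʳ f i < π ⟨$⟩ʳ f j))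

_Contains_ : ∀ {n} → Permutation′ n → Pattern → Set
π Contains (_ , τ) = ∃ (IsOccurrence τ π)

_Avoids_ : ∀ {n} → Permutation′ n → Pattern → Set
π Avoids τ = ¬ (π Contains τ)

-- Two avoiders are equal when the underlying permutations agree pointwise:
-- inverse functions and proofs of avoidance are not compared.
S : ℕ → List Pattern → Setoid 0ℓ 0ℓ
S n T = record
  { Carrier       = Σ (Permutation′ n) λ π → All (π Avoids_) T
  ; _≈_           = λ π ρ → proj₁ π ≈ proj₁ ρ
  ; isEquivalence = record
    { refl  = λ _ → refl
    ; sym   = λ p i → sym (p i)
    ; trans = λ p q i → trans (p i) (q i)
    }
  }

-- The permutation with one-line notation w, given that of its inverse.
-- Entries are shifted down by one, since Fin n starts at 0.
oneLine : ∀ {n} (w w⁻¹ : Vec (Fin n) n) →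
          {True (all? λ i → lookup w (lookup w⁻¹ i) ≟ i)} →
          {True (all? λ i → lookup w⁻¹ (lookup w i) ≟ i)} →
          Permutation′ n
oneLine w w⁻¹ {l} {r} =
  permutation (lookup w) (lookup w⁻¹) (toWitness l) (toWitness r)

p2143 p2341 p3412 p3421 : Pattern
p2143 = 4 , oneLine (1F ∷ 0F ∷ 3F ∷ 2F ∷ []) (1F ∷ 0F ∷ 3F ∷ 2F ∷ [])
p2341 = 4 , oneLine (1F ∷ 2F ∷ 3F ∷ 0F ∷ []) (3F ∷ 0F ∷ 1F ∷ 2F ∷ [])
p3412 = 4 , oneLine (2F ∷ 3F ∷ 0F ∷ 1F ∷ []) (2F ∷ 3F ∷ 0F ∷ 1F ∷ [])
p3421 = 4 , oneLine (2F ∷ 3F ∷ 1F ∷ 0F ∷ []) (3F ∷ 2F ∷ 0F ∷ 1F ∷ [])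

{-# OPTIONS --safe #-}

-- Call a position e low in f when some c < d < e have f e < f c < f d.  In a
-- {2143,2341}-avoider, a single ascent c < d precedes all low positions and
-- exceeds all their values.  Hence the avoider also avoids 3412 (resp. 3421)
-- exactly when its values at the low positions are decreasing (resp.
-- increasing), and rearranging these values among the low positions does not
-- change which positions are low.  Reversing them therefore exchanges the two
-- classes and is its own inverse; it remains to see that it creates no 2143
-- and no 2341.

module Submission where

open import Defs
open import Data.Empty using (⊥)
open import Data.Fin.Base using (Fin; zero; suc; _<_; _≤_; opposite; toℕ)
open import Data.Fin.Induction using (<-wellFounded)
open import Data.Fin.Patterns using (0F; 1F; 2F; 3F)
open import Data.Fin.Permutation using (Permutation′; _≈_; permutation; _⟨$⟩ʳ_; _⟨$⟩ˡ_; _∘ₚ_; inverseˡ; inverseʳ)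
open import Data.Fin.Properties using (<-cmp; _<?_; any?; opposite-prop; toℕ<n; ≤-totalOrder)
open import Data.List.Base using (List; length; _∷_; []; filter; allFin; lookup)
open import Data.List.Extrema using (argmin; argmax; argmin-all; argmax-all; f[argmin]≤f[xs]; f[xs]≤f[argmax])
open import Data.List.Membership.Propositional.Properties using (∈-filter⁺; ∈-filter⁻; ∈-lookup; ∈-allFin)
open import Data.List.Relation.Unary.All as All using (All; _∷_; [])
open import Data.List.Relation.Unary.All.Properties using (all-filter)
open import Data.List.Relation.Unary.AllPairs using (AllPairs; _∷_)
open import Data.List.Relation.Unary.AllPairs.Properties using (tabulate⁺-<; filter⁺)
open import Data.List.Relation.Unary.Any using (index)
open import Data.List.Relation.Unary.Any.Properties using (lookup-index)
open import Data.Nat.Base as ℕ using (ℕ; s≤s; z<s; s<s)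
import Data.Nat.Properties as ℕ
open import Data.Product.Base using (∃; ∃₂; _×_; _,_; proj₂)
open import Data.Sum.Base using (_⊎_; inj₁; inj₂)
open import Data.Vec.Base as Vec using (_∷_; [])
open import Function.Base using (_∘_; id)
open import Function.Bundles using (Bijection; Equivalence; mk⇔)
open import Function.Definitions using (Injective)
open import Function.Properties.Inverse using (Inverse⇒Bijection)
open import Induction.WellFounded using (Acc; acc)
open import Level using (0ℓ)
open import Relation.Binary.Core using (Rel; _Preserves_⟶_)
open import Relation.Binary.Definitions using (tri<; tri≈; tri>; Reflexive)
open import Relation.Binary.PropositionalEquality
  using (_≡_; _≢_; refl; sym; trans; cong; subst; subst₂)
open import Relation.Nullary using (¬_; yes; no; contradiction)
open import Relation.Nullary.Decidable using (_×-dec_)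
open import Relation.Unary using (Pred; Decidable)

private
  variable
    k n : ℕ

-- Reversing a decidable set of positions

-- These three properties determine `ρ`, so reversals of equivalent predicates can be compared
-- without comparing how they are computed.
record Reverses (P : Pred (Fin n) 0ℓ) (ρ : Fin n → Fin n) : Set where
  field
    fixed    : ∀ {i} → ¬ P i → ρ i ≡ i
    closed   : ∀ {i} → P i → P (ρ i)
    antitone : ∀ {i j} → P i → P j → i < j → ρ j < ρ i

opposite-antitone : ∀ {i j : Fin n} → i < j → opposite j < opposite i
opposite-antitone {n} {i} {j} i<j =
  subst₂ ℕ._<_ (sym (opposite-prop j)) (sym (opposite-prop i))
    (ℕ.∸-monoʳ-< (s<s i<j) (toℕ<n j))

lookup-mono-< : ∀ {xs : List (Fin n)} → AllPairs _<_ xs →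
                ∀ {i j} → i < j → lookup xs i < lookup xs j
lookup-mono-< (x< ∷ _)  {zero}  {suc j} _         = All.lookup x< (∈-lookup j)
lookup-mono-< (_ ∷ xs<) {suc i} {suc j} (s≤s i<j) = lookup-mono-< xs< i<j

module _ {P : Pred (Fin n) 0ℓ} (P? : Decidable P) where

  private
    positions : List (Fin n)
    positions = filter P? (allFin n)

    sorted : AllPairs _<_ positions
    sorted = filter⁺ P? (tabulate⁺-< id)

    rank : ∀ {i} → P i → Fin (length positions)
    rank {i} p = index (∈-filter⁺ P? (∈-allFin i) p)

    lookup-rank : ∀ {i} (p : P i) → i ≡ lookup positions (rank p)
    lookup-rank {i} p = lookup-index (∈-filter⁺ P? (∈-allFin i) p)

    rank-mono : ∀ {i j} (p : P i) (q : P j) → i < j → rank p < rank q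
    rank-mono p q i<j with <-cmp (rank p) (rank q)
    ... | tri< r<s _ _ = r<s
    ... | tri≈ _ r≡s _ = contradiction i<j (ℕ.<-irrefl (cong toℕ
          (trans (lookup-rank p) (trans (cong (lookup positions) r≡s) (sym (lookup-rank q))))))
    ... | tri> _ _ s<r = contradiction i<j (ℕ.<-asym
          (subst₂ _<_ (sym (lookup-rank q)) (sym (lookup-rank p)) (lookup-mono-< sorted s<r)))

  reverse : Fin n → Fin n
  reverse i with P? i
  ... | yes p = lookup positions (opposite (rank p))
  ... | no  _ = i

  reverse-reverses : Reverses P reverse
  reverse-reverses = record { fixed = fixed ; closed = closed ; antitone = antitone }
    where
    fixed : ∀ {i} → ¬ P i → reverse i ≡ i
    fixed {i} ¬p with P? i
    ... | yes p = contradiction p ¬p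
    ... | no  _ = refl

    closed : ∀ {i} → P i → P (reverse i)
    closed {i} p with P? i
    ... | yes p′ = proj₂ (∈-filter⁻ P? {xs = allFin n} (∈-lookup (opposite (rank p′))))
    ... | no  ¬p = contradiction p ¬p

    antitone : ∀ {i j} → P i → P j → i < j → reverse j < reverse i
    antitone {i} {j} p q i<j with P? i | P? j
    ... | yes p′ | yes q′ = lookup-mono-< sorted (opposite-antitone (rank-mono p′ q′ i<j))
    ... | no ¬p  | _      = contradiction p ¬p
    ... | yes _  | no ¬q  = contradiction q ¬q

  module _ {ρ ρ′} (r : Reverses P ρ) (r′ : Reverses P ρ′) where
    private
      module R  = Reverses r
      module R′ = Reverses r′

    -- The composite of two antitone maps is strictly increasing on `P`. If it moved `i` down, it
    -- would also move the smaller point `ρ′ (ρ i)` down, against the induction.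
    reversals-inflationary : ∀ {i} → P i → i ≤ ρ′ (ρ i)
    reversals-inflationary {i} p = go p (<-wellFounded i)
      where
      go : ∀ {i} → P i → Acc _<_ i → i ≤ ρ′ (ρ i)
      go {i} p (acc rec) = ℕ.≮⇒≥ λ h →
        let q = R′.closed (R.closed p) in
        ℕ.<⇒≱ (R′.antitone (R.closed p) (R.closed q) (R.antitone q p h)) (go q (rec h))

  reversals-inverse : ∀ {ρ ρ′} → Reverses P ρ → Reverses P ρ′ → ∀ i → ρ′ (ρ i) ≡ i
  reversals-inverse {ρ} {ρ′} r r′ i with P? i
  ... | no ¬p = trans (cong ρ′ (Reverses.fixed r ¬p)) (Reverses.fixed r′ ¬p)
  ... | yes p with <-cmp (ρ′ (ρ i)) i
  ...   | tri< h _ _ = contradiction (reversals-inflationary r r′ p) (ℕ.<⇒≱ h)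
  ...   | tri≈ _ h _ = h
  -- If `ρ′ ∘ ρ` moved `i` up, then `ρ ∘ ρ′` would move `ρ i` down.
  ...   | tri> _ _ h = contradiction (reversals-inflationary r′ r (Reverses.closed r p))
          (ℕ.<⇒≱ (Reverses.antitone r p (Reverses.closed r′ (Reverses.closed r p)) h))

Reverses-resp : ∀ {P Q : Pred (Fin n) 0ℓ} {ρ} →
                (∀ {i} → P i → Q i) → (∀ {i} → Q i → P i) → Reverses P ρ → Reverses Q ρ
Reverses-resp P⊆Q Q⊆P r = record
  { fixed    = λ ¬q → fixed (¬q ∘ P⊆Q)
  ; closed   = P⊆Q ∘ closed ∘ Q⊆P
  ; antitone = λ p q → antitone (Q⊆P p) (Q⊆P q)
  }
  where open Reverses r

-- Avoidance in terms of values

Avoids2143 Avoids2341 Avoids3412 Avoids3421 : (Fin n → Fin n) → Set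
Avoids2143 f = ∀ {i j k l} → i < j → j < k → k < l → f j < f i → f i < f l → f l < f k → ⊥
Avoids2341 f = ∀ {i j k l} → i < j → j < k → k < l → f l < f i → f i < f j → f j < f k → ⊥
Avoids3412 f = ∀ {i j k l} → i < j → j < k → k < l → f k < f l → f l < f i → f i < f j → ⊥
Avoids3421 f = ∀ {i j k l} → i < j → j < k → k < l → f l < f k → f k < f i → f i < f j → ⊥

increasing : ∀ (v : Fin 4 → Fin n) → v 0F < v 1F → v 1F < v 2F → v 2F < v 3F →
             v Preserves _<_ ⟶ _<_
increasing v p q r {0F} {1F} _ = p
increasing v p q r {0F} {2F} _ = ℕ.<-trans p q
increasing v p q r {0F} {3F} _ = ℕ.<-trans p (ℕ.<-trans q r)
increasing v p q r {1F} {2F} _ = q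
increasing v p q r {1F} {3F} _ = ℕ.<-trans q r
increasing v p q r {2F} {3F} _ = r
increasing v p q r {0F} {0F} ()
increasing v p q r {1F} {0F} ()
increasing v p q r {1F} {1F} (s≤s ())
increasing v p q r {2F} {0F} ()
increasing v p q r {2F} {1F} (s≤s ())
increasing v p q r {2F} {2F} (s≤s (s≤s ()))
increasing v p q r {3F} {0F} ()
increasing v p q r {3F} {1F} (s≤s ())
increasing v p q r {3F} {2F} (s≤s (s≤s ()))
increasing v p q r {3F} {3F} (s≤s (s≤s (s≤s ())))

mono-cancel-< : ∀ {g : Fin k → Fin n} → g Preserves _<_ ⟶ _<_ → ∀ {a b} → g a < g b → a < b
mono-cancel-< mono {a} {b} h with <-cmp a b
... | tri< a<b _ _ = a<b
... | tri≈ _ refl _ = contradiction h (ℕ.<-irrefl refl)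
... | tri> _ _ b<a = contradiction h (ℕ.<-asym (mono b<a))

module _ (τ : Permutation′ k) (π : Permutation′ n) (f : Fin k → Fin n) where

  -- The entries of the subsequence in the order of their values in `τ`. Order isomorphism with `τ`
  -- amounts to these being increasing.
  valueAt : Fin k → Fin n
  valueAt a = π ⟨$⟩ʳ f (τ ⟨$⟩ˡ a)

  occurrence⁺ : f Preserves _<_ ⟶ _<_ → valueAt Preserves _<_ ⟶ _<_ → IsOccurrence τ π f
  occurrence⁺ f-mono v-mono = f-mono , λ i j → mk⇔
    (λ h → subst₂ _<_ (eq i) (eq j) (v-mono h))
    (λ h → mono-cancel-< v-mono (subst₂ _<_ (sym (eq i)) (sym (eq j)) h))
    where
    eq : ∀ i → valueAt (τ ⟨$⟩ʳ i) ≡ π ⟨$⟩ʳ f i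
    eq i = cong (λ x → π ⟨$⟩ʳ f x) (inverseˡ τ)

  occurrence⁻ : IsOccurrence τ π f → valueAt Preserves _<_ ⟶ _<_
  occurrence⁻ (_ , iso) h = Equivalence.to (iso _ _) (subst₂ _<_ (sym (inverseʳ τ)) (sym (inverseʳ τ)) h)

module _ (τ : Permutation′ 4) (π : Permutation′ n) where

  -- For a concrete `τ` the inverse evaluates, and these inequalities become literally those of
  -- `Avoids2143` and its companions.
  avoids⁻ : π Avoids (4 , τ) → ∀ {i j k l} → let v = valueAt τ π (Vec.lookup (i ∷ j ∷ k ∷ l ∷ [])) in
            i < j → j < k → k < l → v 0F < v 1F → v 1F < v 2F → v 2F < v 3F → ⊥
  avoids⁻ avoids i<j j<k k<l p q r =
    avoids (f , occurrence⁺ τ π f (increasing f i<j j<k k<l) (increasing (valueAt τ π f) p q r))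
    where f = Vec.lookup (_ ∷ _ ∷ _ ∷ _ ∷ [])

  avoids⁺ : (∀ f → let v = valueAt τ π f in f 0F < f 1F → f 1F < f 2F → f 2F < f 3F →
             v 0F < v 1F → v 1F < v 2F → v 2F < v 3F → ⊥) → π Avoids (4 , τ)
  avoids⁺ h (f , occ@(f-mono , _)) =
    h f (f-mono z<s) (f-mono (s<s z<s)) (f-mono (s<s (s<s z<s)))
        (v-mono z<s) (v-mono (s<s z<s)) (v-mono (s<s (s<s z<s)))
    where
    v-mono : valueAt τ π f Preserves _<_ ⟶ _<_
    v-mono = occurrence⁻ τ π f occ

-- Low positions

module _ (f : Fin n → Fin n) where

  -- These are the positions that end an occurrence of 231.
  Low : Pred (Fin n) 0ℓ
  Low e = ∃₂ λ c d → c < d × d < e × f e < f c × f c < f d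

  low? : Decidable Low
  low? e = any? λ c → any? λ d → c <? d ×-dec d <? e ×-dec f e <? f c ×-dec f c <? f d

  -- The disjunction `LowsMonotone` lets one case analysis serve both directions of the bijection.
  LowsIncrease LowsDecrease LowsMonotone : Set
  LowsIncrease = ∀ {p q} → Low p → Low q → p < q → f p < f q
  LowsDecrease = ∀ {p q} → Low p → Low q → p < q → f q < f p
  LowsMonotone = LowsIncrease ⊎ LowsDecrease

  -- The first two entries of a 3421 make its last two low, and these descend.
  low-increase⇒avoids3421 : LowsIncrease → Avoids3421 f
  low-increase⇒avoids3421 inc i<j j<k k<l l<k k<i i<j′ =
    ℕ.<-asym l<k (inc (_ , _ , i<j , j<k , k<i , i<j′)
      (_ , _ , i<j , ℕ.<-trans j<k k<l , ℕ.<-trans l<k k<i , i<j′) k<l)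

  low-decrease⇒avoids3412 : LowsDecrease → Avoids3412 f
  low-decrease⇒avoids3412 dec i<j j<k k<l k<l′ l<i i<j′ =
    ℕ.<-asym k<l′ (dec (_ , _ , i<j , j<k , ℕ.<-trans k<l′ l<i , i<j′)
      (_ , _ , i<j , ℕ.<-trans j<k k<l , l<i , i<j′) k<l)

module _ {P : Pred (Fin n) 0ℓ} {_≲_ : Rel (Fin n) 0ℓ} (≲-refl : Reflexive _≲_)
         (antitone : ∀ {p q} → P p → P q → p < q → q ≲ p) where

  -- The smaller of `p` and `q` is as early as `p` and bounded in value by `q`, so one position
  -- inherits a place and a value from different sources. The relation `_≲_` is open so that
  -- decreasing and increasing low values are both covered.
  earlier : ∀ {p q} → P p → P q → ∃ λ s → P s × s ≤ p × q ≲ s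
  earlier {p} {q} lp lq with <-cmp p q
  ... | tri< p<q _ _  = p , lp , ℕ.≤-refl , antitone lp lq p<q
  ... | tri≈ _ refl _ = p , lp , ℕ.≤-refl , ≲-refl
  ... | tri> _ _ q<p  = q , lq , ℕ.<⇒≤ q<p , ≲-refl

  later : ∀ {p q} → P p → P q → ∃ λ s → P s × p ≤ s × s ≲ q
  later {p} {q} lp lq with <-cmp p q
  ... | tri< p<q _ _  = q , lq , ℕ.<⇒≤ p<q , ≲-refl
  ... | tri≈ _ refl _ = p , lp , ℕ.≤-refl , ≲-refl
  ... | tri> _ _ q<p  = p , lp , ℕ.≤-refl , antitone lq lp q<p

-- An ascent dominating all low positions

module Avoider {f : Fin n → Fin n} (injective : Injective _≡_ _≡_ f)
               (¬2143 : Avoids2143 f) (¬2341 : Avoids2341 f) where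

  compare : ∀ {i j} → i ≢ j → f i < f j ⊎ f j < f i
  compare {i} {j} i≢j with <-cmp (f i) (f j)
  ... | tri< h _ _ = inj₁ h
  ... | tri≈ _ h _ = contradiction (injective h) i≢j
  ... | tri> _ _ h = inj₂ h

  record Summit : Set where
    field
      {c d} : Fin n
      c<d    : c < d
      fc<fd  : f c < f d
      before : ∀ {e} → Low f e → d < e
      above  : ∀ {e} → Low f e → f e < f c

    -- After `d`, a value below `f c` would be low by way of `c` and `d`.
    small-early : ∀ {g} → ¬ Low f g → f g < f c → g < d
    small-early {g} ¬g fg<fc with <-cmp g d
    ... | tri< g<d _ _ = g<d
    ... | tri≈ _ refl _ = contradiction fg<fc (ℕ.<-asym fc<fd)
    ... | tri> _ _ d<g = contradiction (c , d , c<d , d<g , fg<fc , fc<fd) ¬g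

    late-large : ∀ {e g} → Low f e → ¬ Low f g → e < g → f c < f g
    late-large {e} {g} le ¬g e<g with compare {g} {c} (λ { refl → ℕ.<-asym e<g (ℕ.<-trans c<d (before le)) })
    ... | inj₂ fc<fg = fc<fg
    ... | inj₁ fg<fc = contradiction (ℕ.<-trans (before le) e<g) (ℕ.<-asym (small-early ¬g fg<fc))

  private
    lows : List (Fin n)
    lows = filter (low? f) (allFin n)

    lows-low : All (Low f) lows
    lows-low = all-filter (low? f) (allFin n)

    extremal : ∀ {R : Rel (Fin n) 0ℓ} {m} → All (R m) lows → ∀ {e} → Low f e → R m e
    extremal ms {e} le = All.lookup ms (∈-filter⁺ (low? f) (∈-allFin e) le)

  -- Compare the witnesses of the first low position and of the largest low value.
  summit : ∃ (Low f) → Summit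
  summit (e , le) = choose (argmin-all ≤-tot id {xs = lows} le lows-low) (argmax-all ≤-tot f {xs = lows} le lows-low)
    where
    ≤-tot = ≤-totalOrder n
    -- The default `e` is itself low, so both extrema are low.
    e₀ = argmin ≤-tot id e lows
    e₁ = argmax ≤-tot f e lows

    first : ∀ {e} → Low f e → e₀ ≤ e
    first = extremal {R = λ m e → m ≤ e} (f[argmin]≤f[xs] ≤-tot e lows)

    largest : ∀ {e} → Low f e → f e ≤ f e₁
    largest = extremal {R = λ m e → f e ≤ f m} (f[xs]≤f[argmax] ≤-tot e lows)

    choose : Low f e₀ → Low f e₁ → Summit
    choose le₀@(c , d , c<d , d<e₀ , e₀<c , c<d′) le₁@(c′ , d′ , c′<d′ , d′<e₁ , e₁<c′ , c′<d′′)
      with <-cmp d′ e₀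
    ... | tri< d′<e₀ _ _ = record
      { c<d    = c′<d′
      ; fc<fd  = c′<d′′
      ; before = λ le → ℕ.<-≤-trans d′<e₀ (first le)
      ; above  = λ le → ℕ.≤-<-trans (largest le) e₁<c′
      }
    -- Here `e₀` is `d′`, a low position whose value exceeds the largest low value.
    ... | tri≈ _ refl _ = contradiction (largest le₀) (ℕ.<⇒≱ (ℕ.<-trans e₁<c′ c′<d′′))
    ... | tri> _ _ e₀<d′ with compare {e₁} {c}
           (λ e₁≡c → ℕ.<-irrefl (cong toℕ (sym e₁≡c)) (ℕ.<-trans (ℕ.<-trans c<d d<e₀) (ℕ.<-trans e₀<d′ d′<e₁)))
    ...   | inj₁ e₁<c = record
      { c<d    = c<d
      ; fc<fd  = c<d′
      ; before = λ le → ℕ.<-≤-trans d<e₀ (first le)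
      ; above  = λ le → ℕ.≤-<-trans (largest le) e₁<c
      }
    -- The positions `c`, `e₀`, `d′`, `e₁` form a 2143.
    ...   | inj₂ c<e₁ = contradiction (ℕ.<-trans e₁<c′ c′<d′′)
            (¬2143 (ℕ.<-trans c<d d<e₀) e₀<d′ d′<e₁ e₀<c c<e₁)

  -- The summit followed by an ascent between low positions is a 3412.
  avoids3412⇒low-decrease : Avoids3412 f → LowsDecrease f
  avoids3412⇒low-decrease ¬3412 {p} {q} lp lq p<q with compare {p} {q} (λ { refl → ℕ.<-irrefl refl p<q })
  ... | inj₂ fq<fp = fq<fp
  ... | inj₁ fp<fq = contradiction fc<fd (¬3412 c<d (before lp) p<q fp<fq (above lq))
    where open Summit (summit (p , lp))

  avoids3421⇒low-increase : Avoids3421 f → LowsIncrease f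
  avoids3421⇒low-increase ¬3421 {p} {q} lp lq p<q with compare {p} {q} (λ { refl → ℕ.<-irrefl refl p<q })
  ... | inj₁ fp<fq = fp<fq
  ... | inj₂ fq<fp = contradiction fc<fd (¬3421 c<d (before lp) p<q fq<fp (above lp))
    where open Summit (summit (p , lp))

  -- Reversing the low values of an avoider

  module Reversed {ρ : Fin n → Fin n} (r : Reverses (Low f) ρ) where
    open Reverses r

    σ : Fin n → Fin n
    σ i = f (ρ i)

    -- Indexing by the image ρ i makes σ i = f i definitional in the rest case.
    data View : Fin n → Fin n → Set where
      low  : ∀ {i} → Low f i → Low f (ρ i) → View i (ρ i)
      rest : ∀ {i} → ¬ Low f i → View i i

    view : ∀ i → View i (ρ i)
    view i with low? f i
    ... | yes li = low li (closed li)
    ... | no ¬li = subst (View i) (sym (fixed ¬li)) (rest ¬li)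

    -- The summit precedes every low position, so `ρ` fixes it, and it still exceeds whichever low
    -- value has moved to `e`.
    low⁺ : ∀ {e} → Low f e → Low σ e
    low⁺ {e} le = c , d , c<d , before le ,
      subst (λ x → σ e < f x) (sym ρc≡c) (above (closed le)) ,
      subst₂ (λ x y → f x < f y) (sym ρc≡c) (sym ρd≡d) fc<fd
      where
      open Summit (summit (e , le))
      ρc≡c = fixed λ lc → ℕ.<-asym c<d (before lc)
      ρd≡d = fixed λ ld → ℕ.<-irrefl refl (before ld)

    -- If `e` were not low but one of its witnesses were, then `σ e` would lie below a low value
    -- although `e` comes after a low position, against `late-large`.
    low⁻ : ∀ {e} → Low σ e → Low f e
    low⁻ {e} (c , d , c<d , d<e , e<c , c<d′) = go (view e) (view c) (view d) c<d d<e e<c c<d′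
      where
      go : ∀ {e e′ c c′ d d′} → View e e′ → View c c′ → View d d′ →
           c < d → d < e → f e′ < f c′ → f c′ < f d′ → Low f e
      go (low le _) _ _ _ _ _ _ = le
      go (rest ¬le) (rest _) (rest _) c<d d<e e<c c<d′ = _ , _ , c<d , d<e , e<c , c<d′
      go (rest ¬le) (low lc lc′) _ c<d d<e e<c c<d′ = contradiction
        (ℕ.<-trans e<c (S.above lc′)) (ℕ.<-asym (S.late-large lc ¬le (ℕ.<-trans c<d d<e)))
        where module S = Summit (summit (_ , lc))
      go (rest ¬le) (rest _) (low ld ld′) c<d d<e e<c c<d′ = contradiction
        (ℕ.<-trans (ℕ.<-trans e<c c<d′) (S.above ld′)) (ℕ.<-asym (S.late-large ld ¬le d<e))
        where module S = Summit (summit (_ , ld))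

    reversal-inverse : ∀ {ρ′} → Reverses (Low σ) ρ′ → ∀ i → ρ (ρ′ i) ≡ i
    reversal-inverse r′ = reversals-inverse (low? f) (Reverses-resp low⁻ low⁺ r′) r

    increase⇒decrease : LowsIncrease f → LowsDecrease σ
    increase⇒decrease inc lp lq p<q = inc (closed (low⁻ lq)) (closed (low⁻ lp)) (antitone (low⁻ lp) (low⁻ lq) p<q)

    decrease⇒increase : LowsDecrease f → LowsIncrease σ
    decrease⇒increase dec lp lq p<q = dec (closed (low⁻ lq)) (closed (low⁻ lp)) (antitone (low⁻ lp) (low⁻ lq) p<q)

    -- Reversal swaps the two directions, so one ascent of `σ` between low positions decides the
    -- direction of `f`.
    ascent⇒decrease : LowsMonotone f → ∀ {p q} → Low f p → Low f q → p < q → σ p < σ q → LowsDecrease f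
    ascent⇒decrease (inj₁ inc) lp lq p<q h =
      contradiction h (ℕ.<-asym (inc (closed lq) (closed lp) (antitone lp lq p<q)))
    ascent⇒decrease (inj₂ dec) _ _ _ _ = dec

    descent⇒increase : LowsMonotone f → ∀ {p q} → Low f p → Low f q → p < q → σ q < σ p → LowsIncrease f
    descent⇒increase (inj₁ inc) _ _ _ _ = inc
    descent⇒increase (inj₂ dec) lp lq p<q h =
      contradiction h (ℕ.<-asym (dec (closed lq) (closed lp) (antitone lp lq p<q)))

    ¬2341-low-end : Summit → ∀ {i j k k′ l} → ¬ Low f i → ¬ Low f j → View k k′ → Low f l → Low f (ρ l) →
                    i < j → j < k → k < l → σ l < f i → f i < f j → f j < f k′ → ⊥
    ¬2341-low-end s {i} {j} {k} {k′} {l} ¬i ¬j vk ll ll′ i<j j<k k<l l<i i<j′ j<k′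
      with f j <? f (Summit.c s)
    -- The entry `d` takes the part of `k`, and `ρ l` that of `l`.
    ... | yes j<c = ¬2341 i<j (small-early ¬j j<c) (before ll′) l<i i<j′ (ℕ.<-trans j<c fc<fd)
      where open Summit s
    ... | no j≮c = large vk j<k′
      where
      open Summit s
      large : View k k′ → f j < f k′ → ⊥
      large (low lk lk′) j<k = j≮c (ℕ.<-trans j<k (above lk′))
      large (rest ¬k) j<k′ with compare {i} {l} (λ { refl → ¬i ll }) | <-cmp k (ρ l)
      -- Only `l` carries a moved value. Either `l` itself or `ρ l` completes a 2341 after `i`, `j`,
      -- `k`, or else `i`, `ρ l`, `k`, `l` is a 2143.
      ... | inj₂ l<i′ | _             = ¬2341 i<j j<k k<l l<i′ i<j′ j<k′
      ... | inj₁ _    | tri< k<l′ _ _ = ¬2341 i<j j<k k<l′ l<i i<j′ j<k′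
      ... | inj₁ _    | tri≈ _ refl _ = ¬k ll′
      ... | inj₁ i<l  | tri> _ _ l′<k =
        ¬2143 (ℕ.<-trans (small-early ¬i (ℕ.<-trans i<l (above ll))) (before ll′)) l′<k k<l
          l<i i<l (ℕ.<-trans (above ll) (ℕ.≤-<-trans (ℕ.≮⇒≥ j≮c) j<k′))

    -- The reversal creates no 2143 and no 2341

    module _ (monotone : LowsMonotone f) where

      ascent-descent : ∀ {p q s t} → Low f p → Low f q → p < q → σ p < σ q →
                       Low f s → Low f t → s < t → σ t < σ s → ⊥
      ascent-descent lp lq p<q σp<σq ls lt s<t σt<σs = ℕ.<-asym σt<σs
        (ascent⇒decrease monotone lp lq p<q σp<σq (closed lt) (closed ls) (antitone ls lt s<t))

      ¬2143-view : ∀ {i i′ j j′ k k′ l l′} → View i i′ → View j j′ → View k k′ → View l l′ →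
                   i < j → j < k → k < l → f j′ < f i′ → f i′ < f l′ → f l′ < f k′ → ⊥
      ¬2143-view (low li li′) (low lj _) vk (low ll _) i<j j<k k<l j<i i<l l<k =
        ascent-descent lj ll (ℕ.<-trans j<k k<l) (ℕ.<-trans j<i i<l) li lj i<j j<i
      ¬2143-view (low li li′) (rest ¬j) vk (low ll ll′) i<j j<k k<l j<i i<l l<k =
        -- A small entry that is not low comes before the end of the summit, hence before the low
        -- position `i`.
        ℕ.<-asym (ℕ.<-trans (small-early ¬j (ℕ.<-trans j<i (above li′))) (before li)) i<j
        where open Summit (summit (_ , li))
      ¬2143-view (rest ¬i) (rest ¬j) vk (low ll ll′) i<j j<k k<l j<i i<l l<k =
        -- The entry `d` takes the part of `k`, and `ρ l` that of `l`.
        ¬2143 i<j (small-early ¬j (ℕ.<-trans (ℕ.<-trans j<i i<l) (above ll′))) (before ll′)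
          j<i i<l (ℕ.<-trans (above ll′) fc<fd)
        where open Summit (summit (_ , ll))
      ¬2143-view (rest ¬i) (low lj lj′) (low lk lk′) (low ll ll′) i<j j<k k<l j<i i<l l<k =
        ascent-descent lj ll (ℕ.<-trans j<k k<l) (ℕ.<-trans j<i i<l) lk ll k<l l<k
      ¬2143-view (rest ¬i) (low lj lj′) (rest ¬k) (low ll ll′) i<j j<k k<l j<i i<l l<k =
        -- Here a 2143 of `σ` comes from a 2341 of `f`, namely `i`, `s`, `k`, `t`: `s` is the
        -- earlier of `j` and `ρ l`, and `t` the later of `l` and `ρ j`.
        let dec = ascent⇒decrease monotone lj ll (ℕ.<-trans j<k k<l) (ℕ.<-trans j<i i<l)
            s , ls , s≤j , l≤s = earlier {_≲_ = λ p q → f p ≤ f q} ℕ.≤-refl (λ a b c → ℕ.<⇒≤ (dec a b c)) lj ll′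
            t , lt , l≤t , t≤j = later {_≲_ = λ p q → f p ≤ f q} ℕ.≤-refl (λ a b c → ℕ.<⇒≤ (dec a b c)) ll lj′
        in ¬2341 (ℕ.<-trans (small-early ¬i (ℕ.<-trans i<l (above ll′))) (before ls))
             (ℕ.≤-<-trans s≤j j<k) (ℕ.<-≤-trans k<l l≤t)
             (ℕ.≤-<-trans t≤j j<i) (ℕ.<-≤-trans i<l l≤s)
             (ℕ.<-trans (above ls) (late-large lj ¬k j<k))
        where open Summit (summit (_ , lj))
      ¬2143-view vi vj (low lk lk′) (rest ¬l) i<j j<k k<l j<i i<l l<k =
        ℕ.<-asym (ℕ.<-trans l<k (above lk′)) (late-large lk ¬l k<l)
        where open Summit (summit (_ , lk))
      ¬2143-view (low li _) vj (rest ¬k) (rest ¬l) i<j j<k k<l j<i i<l l<k =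
        -- The pair `c`, `i` supplies the initial descent, with the value of `f` rather than of `σ`
        -- at `i`.
        ¬2143 (ℕ.<-trans c<d (before li)) (ℕ.<-trans i<j j<k) k<l
          (above li) (late-large li ¬l (ℕ.<-trans (ℕ.<-trans i<j j<k) k<l)) l<k
        where open Summit (summit (_ , li))
      ¬2143-view (rest _) (low lj _) (rest ¬k) (rest ¬l) i<j j<k k<l j<i i<l l<k =
        ¬2143 (ℕ.<-trans c<d (before lj)) j<k k<l
          (above lj) (late-large lj ¬l (ℕ.<-trans j<k k<l)) l<k
        where open Summit (summit (_ , lj))
      ¬2143-view (rest _) (rest _) (rest _) (rest _) = ¬2143

      ¬2341-view : ∀ {i i′ j j′ k k′ l l′} → View i i′ → View j j′ → View k k′ → View l l′ →
                   i < j → j < k → k < l → f l′ < f i′ → f i′ < f j′ → f j′ < f k′ → ⊥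
      ¬2341-view (low li li′) vj vk (rest ¬l) i<j j<k k<l l<i i<j′ j<k′ =
        -- An entry that is not low but follows a low position is too large to lie below a low
        -- value.
        ℕ.<-asym (ℕ.<-trans l<i (above li′)) (late-large li ¬l (ℕ.<-trans i<j (ℕ.<-trans j<k k<l)))
        where open Summit (summit (_ , li))
      ¬2341-view (rest _) (low lj lj′) vk (rest ¬l) i<j j<k k<l l<i i<j′ j<k′ =
        ℕ.<-asym (ℕ.<-trans (ℕ.<-trans l<i i<j′) (above lj′)) (late-large lj ¬l (ℕ.<-trans j<k k<l))
        where open Summit (summit (_ , lj))
      ¬2341-view (rest _) (rest _) (low lk lk′) (rest ¬l) i<j j<k k<l l<i i<j′ j<k′ =
        ℕ.<-asym (ℕ.<-trans (ℕ.<-trans l<i (ℕ.<-trans i<j′ j<k′)) (above lk′)) (late-large lk ¬l k<l)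
        where open Summit (summit (_ , lk))
      ¬2341-view (rest _) (rest _) (rest _) (rest _) = ¬2341
      ¬2341-view (low li _) (low lj _) vk (low ll _) i<j j<k k<l l<i i<j′ j<k′ =
        ascent-descent li lj i<j i<j′ li ll (ℕ.<-trans i<j (ℕ.<-trans j<k k<l)) l<i
      ¬2341-view (low li _) (rest ¬j) (low lk lk′) (low ll _) i<j j<k k<l l<i i<j′ j<k′ =
        ℕ.<-asym (ℕ.<-trans j<k′ (above lk′)) (late-large li ¬j i<j)
        where open Summit (summit (_ , li))
      ¬2341-view (low li _) (rest ¬j) (rest _) (low ll _) i<j j<k k<l l<i i<j′ j<k′ =
        -- The entry `c` replaces `i`: its value separates `f l` from `f j`.
        ¬2341 (ℕ.<-trans (ℕ.<-trans c<d (before li)) i<j) j<k k<l (above ll) (late-large li ¬j i<j) j<k′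
        where open Summit (summit (_ , li))
      ¬2341-view (rest ¬i) (low lj _) (low lk _) (low ll _) i<j j<k k<l l<i i<j′ j<k′ =
        ascent-descent lj lk j<k j<k′ lj ll (ℕ.<-trans j<k k<l) (ℕ.<-trans l<i i<j′)
      ¬2341-view (rest ¬i) (low lj lj′) (rest ¬k) (low ll ll′) i<j j<k k<l l<i i<j′ j<k′ =
        -- Conversely, a 2341 of `σ` comes here from the 2143 of `f` at `i`, `s`, `k`, `t`, with the
        -- same choice of `s` and `t`.
        let inc = descent⇒increase monotone lj ll (ℕ.<-trans j<k k<l) (ℕ.<-trans l<i i<j′)
            s , ls , s≤j , s≤l = earlier {_≲_ = λ p q → f q ≤ f p} ℕ.≤-refl (λ a b c → ℕ.<⇒≤ (inc a b c)) lj ll′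
            t , lt , l≤t , j≤t = later {_≲_ = λ p q → f q ≤ f p} ℕ.≤-refl (λ a b c → ℕ.<⇒≤ (inc a b c)) ll lj′
        in ¬2143 (ℕ.<-trans (small-early ¬i (ℕ.<-trans i<j′ (above lj′))) (before ls))
             (ℕ.≤-<-trans s≤j j<k) (ℕ.<-≤-trans k<l l≤t)
             (ℕ.≤-<-trans s≤l l<i) (ℕ.<-≤-trans i<j′ j≤t)
             (ℕ.<-trans (above lt) (late-large lj ¬k j<k))
        where open Summit (summit (_ , lj))
      ¬2341-view (rest ¬i) (rest ¬j) vk (low ll ll′) = ¬2341-low-end (summit (_ , ll)) ¬i ¬j vk ll ll′

      avoids2143 : Avoids2143 σ
      avoids2143 {i} {j} {k} {l} = ¬2143-view (view i) (view j) (view k) (view l)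

      avoids2341 : Avoids2341 σ
      avoids2341 {i} {j} {k} {l} = ¬2341-view (view i) (view j) (view k) (view l)

-- The map on permutations and the bijection

reverseLows : (f : Fin n → Fin n) → Fin n → Fin n
reverseLows f = reverse (low? f)

reverseLows-reverses : (f : Fin n → Fin n) → Reverses (Low f) (reverseLows f)
reverseLows-reverses f = reverse-reverses (low? f)

reverseLows-involutive : ∀ (f : Fin n → Fin n) i → reverseLows f (reverseLows f i) ≡ i
reverseLows-involutive f = reversals-inverse (low? f) (reverseLows-reverses f) (reverseLows-reverses f)

flipLows : Permutation′ n → Permutation′ n
flipLows π = permutation ρ ρ (reverseLows-involutive _) (reverseLows-involutive _) ∘ₚ π
  where ρ = reverseLows (π ⟨$⟩ʳ_)

private
  injective : ∀ (π : Permutation′ n) → Injective _≡_ _≡_ (π ⟨$⟩ʳ_)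
  injective π = Bijection.injective (Inverse⇒Bijection π)

-- Pointwise equality does not identify the two computed reversals. Both reverse the same set,
-- however, so each is inverse to the other and to itself.
flipLows-cong : ∀ {π π′ : Permutation′ n} → π ≈ π′ → flipLows π ≈ flipLows π′
flipLows-cong {π = π} {π′} π≈π′ i = trans (π≈π′ _) (cong (π′ ⟨$⟩ʳ_) ρi≡ρ′i)
  where
  f = π ⟨$⟩ʳ_
  f′ = π′ ⟨$⟩ʳ_
  low-resp : ∀ {g h : Fin _ → Fin _} → (∀ i → g i ≡ h i) → ∀ {e} → Low g e → Low h e
  low-resp g≗h (c , d , c<d , d<e , e<c , c<d′) =
    c , d , c<d , d<e , subst₂ _<_ (g≗h _) (g≗h _) e<c , subst₂ _<_ (g≗h _) (g≗h _) c<d′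
  r′ : Reverses (Low f) (reverseLows f′)
  r′ = Reverses-resp (low-resp (sym ∘ π≈π′)) (low-resp π≈π′) (reverseLows-reverses f′)
  ρi≡ρ′i : reverseLows f i ≡ reverseLows f′ i
  ρi≡ρ′i = trans (sym (reverseLows-involutive f′ _))
    (cong (reverseLows f′) (reversals-inverse (low? f) (reverseLows-reverses f) r′ i))

flipLows-involutive : ∀ (π : Permutation′ n) → Avoids2143 (π ⟨$⟩ʳ_) → Avoids2341 (π ⟨$⟩ʳ_) →
                      flipLows (flipLows π) ≈ π
flipLows-involutive π ¬2143 ¬2341 i =
  cong (π ⟨$⟩ʳ_) (reversal-inverse (reverseLows-reverses (flipLows π ⟨$⟩ʳ_)) i)
  where
  open Avoider (injective π) ¬2143 ¬2341
  open Reversed (reverseLows-reverses (π ⟨$⟩ʳ_))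

module _ (π : Permutation′ n) where

  private f = π ⟨$⟩ʳ_

  2143⁻ : π Avoids p2143 → Avoids2143 f
  2143⁻ a = avoids⁻ (proj₂ p2143) π a

  2341⁻ : π Avoids p2341 → Avoids2341 f
  2341⁻ a = avoids⁻ (proj₂ p2341) π a

  3412⁻ : π Avoids p3412 → Avoids3412 f
  3412⁻ a = avoids⁻ (proj₂ p3412) π a

  3421⁻ : π Avoids p3421 → Avoids3421 f
  3421⁻ a = avoids⁻ (proj₂ p3421) π a

  2143⁺ : Avoids2143 f → π Avoids p2143
  2143⁺ h = avoids⁺ (proj₂ p2143) π λ _ → h

  2341⁺ : Avoids2341 f → π Avoids p2341
  2341⁺ h = avoids⁺ (proj₂ p2341) π λ _ → h

  3412⁺ : Avoids3412 f → π Avoids p3412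
  3412⁺ h = avoids⁺ (proj₂ p3412) π λ _ → h

  3421⁺ : Avoids3421 f → π Avoids p3421
  3421⁺ h = avoids⁺ (proj₂ p3421) π λ _ → h

-- The tail `T` stays open so that both inverse laws are instances.
flipLows-inverse : ∀ (π : Permutation′ n) {T} → All (π Avoids_) (p2143 ∷ p2341 ∷ T) →
                   ∀ {π′} → π′ ≈ flipLows π → flipLows π′ ≈ π
flipLows-inverse π (a ∷ b ∷ _) {π′} π′≈ i =
  trans (flipLows-cong {π = π′} {flipLows π} π′≈ i) (flipLows-involutive π (2143⁻ π a) (2341⁻ π b) i)

flipLows-3412 : (π : Permutation′ n) → All (π Avoids_) (p2143 ∷ p2341 ∷ p3412 ∷ []) →
                All (flipLows π Avoids_) (p2143 ∷ p2341 ∷ p3421 ∷ [])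
flipLows-3412 π (a ∷ b ∷ c ∷ []) =
  2143⁺ (flipLows π) (avoids2143 (inj₂ dec)) ∷ 2341⁺ (flipLows π) (avoids2341 (inj₂ dec)) ∷
  3421⁺ (flipLows π) (low-increase⇒avoids3421 σ (decrease⇒increase dec)) ∷ []
  where
  open Avoider (injective π) (2143⁻ π a) (2341⁻ π b)
  open Reversed (reverseLows-reverses (π ⟨$⟩ʳ_))
  dec = avoids3412⇒low-decrease (3412⁻ π c)

flipLows-3421 : (π : Permutation′ n) → All (π Avoids_) (p2143 ∷ p2341 ∷ p3421 ∷ []) →
                All (flipLows π Avoids_) (p2143 ∷ p2341 ∷ p3412 ∷ [])
flipLows-3421 π (a ∷ b ∷ c ∷ []) =
  2143⁺ (flipLows π) (avoids2143 (inj₁ inc)) ∷ 2341⁺ (flipLows π) (avoids2341 (inj₁ inc)) ∷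
  3412⁺ (flipLows π) (low-decrease⇒avoids3412 σ (increase⇒decrease inc)) ∷ []
  where
  open Avoider (injective π) (2143⁻ π a) (2341⁻ π b)
  open Reversed (reverseLows-reverses (π ⟨$⟩ʳ_))
  inc = avoids3421⇒low-increase (3421⁻ π c)

theorem5 : (n : ℕ) → Bijection (S n (p2143 ∷ p2341 ∷ p3412 ∷ [])) (S n (p2143 ∷ p2341 ∷ p3421 ∷ []))
theorem5 n = Inverse⇒Bijection record
  { to        = λ (π , a) → flipLows π , flipLows-3412 π a
  ; from      = λ (π , a) → flipLows π , flipLows-3421 π a
  ; to-cong   = λ {(π , _)} {(π′ , _)} → flipLows-cong {π = π} {π′}
  ; from-cong = λ {(π , _)} {(π′ , _)} → flipLows-cong {π = π} {π′}
  ; inverse   = (λ {(π , a)} {(π′ , _)} → flipLows-inverse π a {π′})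
              , (λ {(π , a)} {(π′ , _)} → flipLows-inverse π a {π′})
  }
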